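{- Let $S,T$ be as in the context and let $n,k\geq 1$ be natural numbers. If $\mathrm{Pr}_T(x)$ is a $\Sigma_1$ provability predicate of $T$ satisfying $\mathbf{E}$, $\mathbf{C}$ and $\mathbf{D3}^n_{n+k}$, then $T\nvdash\mathrm{Con}^{\mathrm{L}}_T$.
   Context: $\mathcal{L}_A=\{0,\mathsf{s},+,\times,\leq\}$ is the language of first-order arithmetic, and "formula" means $\mathcal{L}_A$-formula; $\ulcorner\varphi\urcorner$ is the numeral of the Gödel number of $\varphi$. $S$ and $T$ are consistent c.e. extensions of Peano Arithmetic $\mathsf{PA}$ in the language $\mathcal{L}_A$ such that $T$ is stronger than $S$ (every theorem of $S$ is a theorem of $T$; $S=T$ is allowed). A formula $\mathrm{Pr}_T(x)$ is a provability predicate of $T$ if for every formula $\varphi$: $T\vdash\varphi$ if and only if $S\vdash\mathrm{Pr}_T(\ulcorner\varphi\urcorner)$. A $\Sigma_1$ provability predicate is one that is a $\Sigma_1$ formula. $\mathrm{Con}^{\mathrm{L}}_T :\equiv \neg\,\mathrm{Pr}_T(\ulcorner 0=1\urcorner)$. Define $\mathrm{Pr}_T^0(\ulcorner\varphi\urcorner)$ to be $\varphi$ and $\mathrm{Pr}_T^{i+1}(\ulcorner\varphi\urcorner)$ to be $\mathrm{Pr}_T(\ulcorner\mathrm{Pr}_T^i(\ulcorner\varphi\urcorner)\urcorner)$. Conditions on $\mathrm{Pr}_T(x)$: - $\mathbf{E}$: for all formulas $\varphi,\psi$, if $T\vdash\varphi\leftrightarrow\psi$, then $S\vdash\mathrm{Pr}_T(\ulcorner\varphi\urcorner)\leftrightarrow\mathrm{Pr}_T(\ulcorner\psi\urcorner)$.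 - $\mathbf{C}$: $S\vdash\mathrm{Pr}_T(\ulcorner\varphi\urcorner)\land\mathrm{Pr}_T(\ulcorner\psi\urcorner)\to\mathrm{Pr}_T(\ulcorner\varphi\land\psi\urcorner)$ for all formulas $\varphi,\psi$. - $\mathbf{D3}^n_m$: $S\vdash\mathrm{Pr}_T^n(\ulcorner\varphi\urcorner)\to\mathrm{Pr}_T^m(\ulcorner\varphi\urcorner)$ for every formula $\varphi$. -}

module Defs where

open import Data.Fin using (Fin)
open import Data.List using (List; []; _∷_; map)
open import Data.List.Membership.Propositional using (_∈_)
open import Data.Nat using (ℕ; zero; suc; _+_; _*_; _<_)
open import Data.Product using (_×_; ∃-syntax)
open import Data.Unit using (⊤)
open import Data.Vec using (Vec; []; _∷_; lookup)
open import Data.Vec.Relation.Binary.Pointwise.Inductive using (Pointwise)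
open import Function.Bundles using (_⇔_)
open import Relation.Binary.PropositionalEquality using (_≡_)
open import Relation.Nullary using (¬_)

infixl 40 _⊕_
infixl 45 _⊗_
infix  30 _≐_ _≼_
infixr 25 _∧̇_
infixr 24 _∨̇_
infixr 23 _⇒_
infix  22 _⇔̇_

-- Formulas are de Bruijn terms: variables are natural numbers, a quantifier
-- binds index 0 of its body, and indices not bound are free variables.

data Term : Set where
  var     : ℕ → Term
  𝟘       : Term
  𝗌       : Term → Term
  _⊕_ _⊗_ : Term → Term → Term

data Formula : Set where
  _≐_ _≼_        : Term → Term → Formula
  ⊥̇              : Formula
  _⇒_ _∧̇_ _∨̇_    : Formula → Formula → Formula
  ∀̇_ ∃̇_          : Formula → Formula

infix 35 ∀̇_ ∃̇_ ¬̇_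

¬̇_ : Formula → Formula
¬̇ φ = φ ⇒ ⊥̇

_⇔̇_ : Formula → Formula → Formula
φ ⇔̇ ψ = (φ ⇒ ψ) ∧̇ (ψ ⇒ φ)

numeral : ℕ → Term
numeral zero    = 𝟘
numeral (suc n) = 𝗌 (numeral n)

Substitution : Set
Substitution = ℕ → Term

substᵗ : Substitution → Term → Term
substᵗ σ (var i) = σ i
substᵗ σ 𝟘       = 𝟘
substᵗ σ (𝗌 t)   = 𝗌 (substᵗ σ t)
substᵗ σ (s ⊕ t) = substᵗ σ s ⊕ substᵗ σ t
substᵗ σ (s ⊗ t) = substᵗ σ s ⊗ substᵗ σ t

shift : Substitution
shift i = var (suc i)

under : Substitution → Substitution
under σ zero    = var zero
under σ (suc i) = substᵗ shift (σ i)

subst : Substitution → Formula → Formula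
subst σ (s ≐ t)  = substᵗ σ s ≐ substᵗ σ t
subst σ (s ≼ t)  = substᵗ σ s ≼ substᵗ σ t
subst σ ⊥̇        = ⊥̇
subst σ (φ ⇒ ψ)  = subst σ φ ⇒ subst σ ψ
subst σ (φ ∧̇ ψ)  = subst σ φ ∧̇ subst σ ψ
subst σ (φ ∨̇ ψ)  = subst σ φ ∨̇ subst σ ψ
subst σ (∀̇ φ)    = ∀̇ (subst (under σ) φ)
subst σ (∃̇ φ)    = ∃̇ (subst (under σ) φ)

instantiate : Term → Substitution
instantiate t zero    = t
instantiate t (suc i) = var i

_[_] : Formula → Term → Formula
φ [ t ] = subst (instantiate t) φ

infix 50 _[_]

-- Scoped n φ: every free variable of φ has index below n.

Scopedᵗ : ℕ → Term → Set
Scopedᵗ n (var i) = i < n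
Scopedᵗ n 𝟘       = ⊤
Scopedᵗ n (𝗌 t)   = Scopedᵗ n t
Scopedᵗ n (s ⊕ t) = Scopedᵗ n s × Scopedᵗ n t
Scopedᵗ n (s ⊗ t) = Scopedᵗ n s × Scopedᵗ n t

Scoped : ℕ → Formula → Set
Scoped n (s ≐ t)  = Scopedᵗ n s × Scopedᵗ n t
Scoped n (s ≼ t)  = Scopedᵗ n s × Scopedᵗ n t
Scoped n ⊥̇        = ⊤
Scoped n (φ ⇒ ψ)  = Scoped n φ × Scoped n ψ
Scoped n (φ ∧̇ ψ)  = Scoped n φ × Scoped n ψ
Scoped n (φ ∨̇ ψ)  = Scoped n φ × Scoped n ψ
Scoped n (∀̇ φ)    = Scoped (suc n) φ
Scoped n (∃̇ φ)    = Scoped (suc n) φ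

Sentence : Formula → Set
Sentence = Scoped 0

-- In a bounded quantifier the bounding term must not contain the bound
-- variable, hence the shift.

data Δ₀ : Formula → Set where
  eq  : ∀ s t → Δ₀ (s ≐ t)
  le  : ∀ s t → Δ₀ (s ≼ t)
  bot : Δ₀ ⊥̇
  imp : ∀ {φ ψ} → Δ₀ φ → Δ₀ ψ → Δ₀ (φ ⇒ ψ)
  and : ∀ {φ ψ} → Δ₀ φ → Δ₀ ψ → Δ₀ (φ ∧̇ ψ)
  or  : ∀ {φ ψ} → Δ₀ φ → Δ₀ ψ → Δ₀ (φ ∨̇ ψ)
  all : ∀ {φ} t → Δ₀ φ → Δ₀ (∀̇ (var 0 ≼ substᵗ shift t ⇒ φ))
  ex  : ∀ {φ} t → Δ₀ φ → Δ₀ (∃̇ (var 0 ≼ substᵗ shift t ∧̇ φ))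

data Σ₁ : Formula → Set where
  Δ₀⊆Σ₁ : ∀ {φ} → Δ₀ φ → Σ₁ φ
  ex    : ∀ {φ} → Σ₁ φ → Σ₁ (∃̇ φ)

-- A theory is given by its set of axioms.

Theory : Set₁
Theory = Formula → Set

infix 10 _∣_⊢_ _⊢_ _⊬_

-- Classical natural deduction with equality.  The axioms of T, unlike the
-- hypotheses Γ, are not shifted under a quantifier: they are meant to be
-- sentences.

data _∣_⊢_ (T : Theory) : List Formula → Formula → Set where
  axiom : ∀ {Γ φ} → T φ → T ∣ Γ ⊢ φ
  hyp   : ∀ {Γ φ} → φ ∈ Γ → T ∣ Γ ⊢ φ
  raa   : ∀ {Γ φ} → T ∣ ¬̇ φ ∷ Γ ⊢ ⊥̇ → T ∣ Γ ⊢ φ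
  ⇒I    : ∀ {Γ φ ψ} → T ∣ φ ∷ Γ ⊢ ψ → T ∣ Γ ⊢ φ ⇒ ψ
  ⇒E    : ∀ {Γ φ ψ} → T ∣ Γ ⊢ φ ⇒ ψ → T ∣ Γ ⊢ φ → T ∣ Γ ⊢ ψ
  ∧I    : ∀ {Γ φ ψ} → T ∣ Γ ⊢ φ → T ∣ Γ ⊢ ψ → T ∣ Γ ⊢ φ ∧̇ ψ
  ∧E₁   : ∀ {Γ φ ψ} → T ∣ Γ ⊢ φ ∧̇ ψ → T ∣ Γ ⊢ φ
  ∧E₂   : ∀ {Γ φ ψ} → T ∣ Γ ⊢ φ ∧̇ ψ → T ∣ Γ ⊢ ψ
  ∨I₁   : ∀ {Γ φ ψ} → T ∣ Γ ⊢ φ → T ∣ Γ ⊢ φ ∨̇ ψ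
  ∨I₂   : ∀ {Γ φ ψ} → T ∣ Γ ⊢ ψ → T ∣ Γ ⊢ φ ∨̇ ψ
  ∨E    : ∀ {Γ φ ψ χ} → T ∣ Γ ⊢ φ ∨̇ ψ → T ∣ φ ∷ Γ ⊢ χ → T ∣ ψ ∷ Γ ⊢ χ → T ∣ Γ ⊢ χ
  ∀I    : ∀ {Γ φ} → T ∣ map (subst shift) Γ ⊢ φ → T ∣ Γ ⊢ ∀̇ φ
  ∀E    : ∀ {Γ φ} t → T ∣ Γ ⊢ ∀̇ φ → T ∣ Γ ⊢ φ [ t ]
  ∃I    : ∀ {Γ φ} t → T ∣ Γ ⊢ φ [ t ] → T ∣ Γ ⊢ ∃̇ φ
  ∃E    : ∀ {Γ φ χ} → T ∣ Γ ⊢ ∃̇ φ → T ∣ φ ∷ map (subst shift) Γ ⊢ subst shift χ → T ∣ Γ ⊢ χ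
  ≐refl : ∀ {Γ} t → T ∣ Γ ⊢ t ≐ t
  ≐E    : ∀ {Γ s t} φ → T ∣ Γ ⊢ s ≐ t → T ∣ Γ ⊢ φ [ s ] → T ∣ Γ ⊢ φ [ t ]

_⊢_ : Theory → Formula → Set
T ⊢ φ = T ∣ [] ⊢ φ

_⊬_ : Theory → Formula → Set
T ⊬ φ = ¬ (T ⊢ φ)

Consistent : Theory → Set
Consistent T = T ⊬ ⊥̇

_⊑_ : Theory → Theory → Set
S ⊑ T = ∀ φ → S ⊢ φ → T ⊢ φ

infix 10 _⊑_

∀̇^ : ℕ → Formula → Formula
∀̇^ zero    φ = φ
∀̇^ (suc n) φ = ∀̇ (∀̇^ n φ)

successor : Substitution
successor zero    = 𝗌 (var 0)
successor (suc i) = var (suc i)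

data PA : Theory where
  s≢0  : PA (∀̇ (¬̇ (𝗌 (var 0) ≐ 𝟘)))
  sinj : PA (∀̇ (∀̇ (𝗌 (var 1) ≐ 𝗌 (var 0) ⇒ var 1 ≐ var 0)))
  +0   : PA (∀̇ (var 0 ⊕ 𝟘 ≐ var 0))
  +s   : PA (∀̇ (∀̇ (var 1 ⊕ 𝗌 (var 0) ≐ 𝗌 (var 1 ⊕ var 0))))
  ×0   : PA (∀̇ (var 0 ⊗ 𝟘 ≐ 𝟘))
  ×s   : PA (∀̇ (∀̇ (var 1 ⊗ 𝗌 (var 0) ≐ var 1 ⊗ var 0 ⊕ var 1)))
  ≤def : PA (∀̇ (∀̇ (var 1 ≼ var 0 ⇔̇ ∃̇ (var 0 ⊕ var 2 ≐ var 1))))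
  -- Induction on variable 0 of φ, with its other free variables as parameters.
  ind  : ∀ n φ → Scoped (suc n) φ →
         PA (∀̇^ n (φ [ 𝟘 ] ∧̇ ∀̇ (φ ⇒ subst successor φ) ⇒ ∀̇ φ))

-- This pairing is injective, since (x + y)² ≤ ⟪ x , y ⟫ < (x + y + 1)².

⟪_,_⟫ : ℕ → ℕ → ℕ
⟪ x , y ⟫ = (x + y) * (x + y) + x

⌜_⌝ᵗ : Term → ℕ
⌜ 𝟘 ⌝ᵗ     = ⟪ 0 , 0 ⟫
⌜ 𝗌 t ⌝ᵗ   = ⟪ 1 , ⌜ t ⌝ᵗ ⟫
⌜ s ⊕ t ⌝ᵗ = ⟪ 2 , ⟪ ⌜ s ⌝ᵗ , ⌜ t ⌝ᵗ ⟫ ⟫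
⌜ s ⊗ t ⌝ᵗ = ⟪ 3 , ⟪ ⌜ s ⌝ᵗ , ⌜ t ⌝ᵗ ⟫ ⟫
⌜ var i ⌝ᵗ = ⟪ 4 , i ⟫

gödel : Formula → ℕ
gödel (s ≐ t)  = ⟪ 0 , ⟪ ⌜ s ⌝ᵗ , ⌜ t ⌝ᵗ ⟫ ⟫
gödel (s ≼ t)  = ⟪ 1 , ⟪ ⌜ s ⌝ᵗ , ⌜ t ⌝ᵗ ⟫ ⟫
gödel ⊥̇        = ⟪ 2 , 0 ⟫
gödel (φ ⇒ ψ)  = ⟪ 3 , ⟪ gödel φ , gödel ψ ⟫ ⟫
gödel (φ ∧̇ ψ)  = ⟪ 4 , ⟪ gödel φ , gödel ψ ⟫ ⟫
gödel (φ ∨̇ ψ)  = ⟪ 5 , ⟪ gödel φ , gödel ψ ⟫ ⟫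
gödel (∀̇ φ)    = ⟪ 6 , gödel φ ⟫
gödel (∃̇ φ)    = ⟪ 7 , gödel φ ⟫

⌜_⌝ : Formula → Term
⌜ φ ⌝ = numeral (gödel φ)

-- Kleene's partial recursive functions, by their programs.

data PartRec : ℕ → Set where
  zer  : PartRec 0
  succ : PartRec 1
  proj : ∀ {n} → Fin n → PartRec n
  comp : ∀ {m n} → PartRec m → Vec (PartRec n) m → PartRec n
  prec : ∀ {n} → PartRec n → PartRec (suc (suc n)) → PartRec (suc n)
  mu   : ∀ {n} → PartRec (suc n) → PartRec n

infix 10 _$_↦_

data _$_↦_ : ∀ {n} → PartRec n → Vec ℕ n → ℕ → Set where
  zer   : zer $ [] ↦ 0
  succ  : ∀ x → succ $ x ∷ [] ↦ suc x
  proj  : ∀ {n} (i : Fin n) xs → proj i $ xs ↦ lookup xs i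
  comp  : ∀ {m n} {f : PartRec m} {gs : Vec (PartRec n) m} {xs ys z} →
          Pointwise (λ g y → g $ xs ↦ y) gs ys → f $ ys ↦ z → comp f gs $ xs ↦ z
  prec0 : ∀ {n} {f : PartRec n} {g xs z} →
          f $ xs ↦ z → prec f g $ 0 ∷ xs ↦ z
  precs : ∀ {n} {f : PartRec n} {g x xs y z} →
          prec f g $ x ∷ xs ↦ y → g $ x ∷ y ∷ xs ↦ z → prec f g $ suc x ∷ xs ↦ z
  mu    : ∀ {n} {f : PartRec (suc n)} {xs y} →
          f $ y ∷ xs ↦ 0 → (∀ i → i < y → ∃[ v ] (f $ i ∷ xs ↦ suc v)) → mu f $ xs ↦ y

CE : (ℕ → Set) → Set
CE X = ∃[ f ] (∀ x → X x ⇔ (∃[ y ] (f $ x ∷ [] ↦ y)))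

record ConsistentCEExtensionOfPA (T : Theory) : Set where
  field
    sentences  : ∀ φ → T φ → Sentence φ
    ce         : CE (λ x → ∃[ φ ] (T φ × gödel φ ≡ x))
    extendsPA  : PA ⊑ T
    consistent : Consistent T

-- In what follows Pr is a formula whose only free variable is variable 0.

record IsProvabilityPredicate (S T : Theory) (Pr : Formula) : Set where
  field
    unary   : Scoped 1 Pr
    correct : ∀ φ → T ⊢ φ ⇔ S ⊢ Pr [ ⌜ φ ⌝ ]

Con : Formula → Formula
Con Pr = ¬̇ Pr [ ⌜ 𝟘 ≐ 𝗌 𝟘 ⌝ ]

iterate : Formula → ℕ → Formula → Formula
iterate Pr zero    φ = φ
iterate Pr (suc i) φ = Pr [ ⌜ iterate Pr i φ ⌝ ]

E : (S T : Theory) → Formula → Set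
E S T Pr = ∀ φ ψ → T ⊢ φ ⇔̇ ψ → S ⊢ Pr [ ⌜ φ ⌝ ] ⇔̇ Pr [ ⌜ ψ ⌝ ]

C : (S : Theory) → Formula → Set
C S Pr = ∀ φ ψ → S ⊢ Pr [ ⌜ φ ⌝ ] ∧̇ Pr [ ⌜ ψ ⌝ ] ⇒ Pr [ ⌜ φ ∧̇ ψ ⌝ ]

D3 : (n m : ℕ) (S : Theory) → Formula → Set
D3 n m S Pr = ∀ φ → S ⊢ iterate Pr n φ ⇒ iterate Pr m φ

{-# OPTIONS --safe #-}
module Submission where

-- Suppose T ⊢ Con.  By E and C, whenever T refutes φ ∧ ψ it refutes Pr φ ∧ Pr ψ; likewise,
-- whenever T refutes φ it refutes Pr φ.  Put K = n k and let G be a fixed point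
-- G ⇔ ¬ Pr^K G.  As T refutes G ∧ Pr^K G, it refutes Pr^n G ∧ Pr^(n+K) G, and iterating
-- D3 (Pr^n G → Pr^(n+K) G) it refutes Pr^n G.  Since K ≥ n it also refutes Pr^K G, so it
-- proves G, hence Pr^n G: a contradiction.
--
-- For the fixed point, replace θ(n) by the equivalent ∃x (x = n ∧ θ): its Gödel number is
-- a polynomial in that of θ and in the code of the numeral of n, so the map n ↦ code of
-- numeral n is the only function that has to be represented in PA.

open import Defs
open import Data.List using (List; _∷_; map)
open import Data.List.Relation.Binary.Subset.Propositional using (_⊆_)
open import Data.List.Relation.Binary.Subset.Propositional.Properties using (map⁺; ∷⁺ʳ)
open import Data.List.Relation.Unary.Any using (here; there)
open import Data.Nat using (ℕ; zero; suc; _+_; _*_; _!; _≥_; _≤_; _<_; z≤n; s≤s; _≤′_; ≤′-refl; ≤′-step)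
open import Data.Nat.Properties using (≤-refl; ≤-trans; ≤-pred; m≤m+n; m≤n+m; +-comm; *-comm; m≤n⇒m≤1+n; m≤n⇒m<n∨m≡n; _≟_; _≤?_; +-identityʳ; +-assoc; +-suc; *-distribʳ-+; m≤n⇒∃[o]m+o≡n; <-cmp; m≤m*n; <⇒≤; +-mono-≤; *-mono-≤; 1≤n!; +-cancelˡ-≡; <-irrefl; n<1+n; ≤-reflexive; ≤⇒≤′; ≤-<-trans; +-monoʳ-≤)
open import Data.Nat.Coprimality as Coprimality using (Coprime; coprime-divisor)
open import Data.Nat.Divisibility using (divides; ∣-refl; ∣-trans; ∣1⇒≡1; ∣m+n∣m⇒∣n; m∣m*n; n∣m*n; ∣n⇒∣m*n; m≤n⇒m!∣n!) renaming (_∣_ to _∣ₙ_)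
open import Data.Nat.Tactic.RingSolver using (solve-∀)
open import Data.Product using (_×_; _,_; ∃-syntax; proj₁; proj₂)
open import Data.Sum using (_⊎_; inj₁; inj₂; [_,_]′; swap)
open import Data.Empty using (⊥; ⊥-elim)
open import Function using (_∘_; _∘′_; id)
open import Function.Bundles using (Equivalence)
open import Relation.Binary.Definitions using (tri<; tri≈; tri>)
open import Relation.Binary.PropositionalEquality as ≡ using (_≡_; _≢_; _≗_; refl; sym; trans; cong; cong₂)
open import Relation.Nullary using (¬_; yes; no)

infixr 20 _∙_
infixl 10 _∼_

private variable
  U : Theory
  Γ Δ : List Formula
  φ ψ χ : Formula
  s t u : Term
  σ τ : Substitution

-- Substitutions

_∙_ : Term → Substitution → Substitution
(t ∙ σ) zero    = t
(t ∙ σ) (suc i) = σ i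

substᵗ-cong : σ ≗ τ → ∀ t → substᵗ σ t ≡ substᵗ τ t
substᵗ-cong e (var i) = e i
substᵗ-cong e 𝟘       = refl
substᵗ-cong e (𝗌 t)   = cong 𝗌 (substᵗ-cong e t)
substᵗ-cong e (s ⊕ t) = cong₂ _⊕_ (substᵗ-cong e s) (substᵗ-cong e t)
substᵗ-cong e (s ⊗ t) = cong₂ _⊗_ (substᵗ-cong e s) (substᵗ-cong e t)

under-cong : σ ≗ τ → under σ ≗ under τ
under-cong e zero    = refl
under-cong e (suc i) = cong (substᵗ shift) (e i)

subst-cong : σ ≗ τ → ∀ φ → subst σ φ ≡ subst τ φ
subst-cong e (s ≐ t) = cong₂ _≐_ (substᵗ-cong e s) (substᵗ-cong e t)
subst-cong e (s ≼ t) = cong₂ _≼_ (substᵗ-cong e s) (substᵗ-cong e t)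
subst-cong e ⊥̇       = refl
subst-cong e (φ ⇒ ψ) = cong₂ _⇒_ (subst-cong e φ) (subst-cong e ψ)
subst-cong e (φ ∧̇ ψ) = cong₂ _∧̇_ (subst-cong e φ) (subst-cong e ψ)
subst-cong e (φ ∨̇ ψ) = cong₂ _∨̇_ (subst-cong e φ) (subst-cong e ψ)
subst-cong e (∀̇ φ)   = cong ∀̇_ (subst-cong (under-cong e) φ)
subst-cong e (∃̇ φ)   = cong ∃̇_ (subst-cong (under-cong e) φ)

substᵗ-∘ : ∀ σ τ t → substᵗ σ (substᵗ τ t) ≡ substᵗ (substᵗ σ ∘ τ) t
substᵗ-∘ σ τ (var i) = refl
substᵗ-∘ σ τ 𝟘       = refl
substᵗ-∘ σ τ (𝗌 t)   = cong 𝗌 (substᵗ-∘ σ τ t)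
substᵗ-∘ σ τ (s ⊕ t) = cong₂ _⊕_ (substᵗ-∘ σ τ s) (substᵗ-∘ σ τ t)
substᵗ-∘ σ τ (s ⊗ t) = cong₂ _⊗_ (substᵗ-∘ σ τ s) (substᵗ-∘ σ τ t)

under-∘ : ∀ σ τ → substᵗ (under σ) ∘ under τ ≗ under (substᵗ σ ∘ τ)
under-∘ σ τ zero    = refl
under-∘ σ τ (suc i) = trans (substᵗ-∘ (under σ) shift (τ i)) (sym (substᵗ-∘ shift σ (τ i)))

subst-∘ : ∀ σ τ φ → subst σ (subst τ φ) ≡ subst (substᵗ σ ∘ τ) φ
subst-∘ σ τ (s ≐ t) = cong₂ _≐_ (substᵗ-∘ σ τ s) (substᵗ-∘ σ τ t)
subst-∘ σ τ (s ≼ t) = cong₂ _≼_ (substᵗ-∘ σ τ s) (substᵗ-∘ σ τ t)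
subst-∘ σ τ ⊥̇       = refl
subst-∘ σ τ (φ ⇒ ψ) = cong₂ _⇒_ (subst-∘ σ τ φ) (subst-∘ σ τ ψ)
subst-∘ σ τ (φ ∧̇ ψ) = cong₂ _∧̇_ (subst-∘ σ τ φ) (subst-∘ σ τ ψ)
subst-∘ σ τ (φ ∨̇ ψ) = cong₂ _∨̇_ (subst-∘ σ τ φ) (subst-∘ σ τ ψ)
subst-∘ σ τ (∀̇ φ)   = cong ∀̇_ (trans (subst-∘ (under σ) (under τ) φ) (subst-cong (under-∘ σ τ) φ))
subst-∘ σ τ (∃̇ φ)   = cong ∃̇_ (trans (subst-∘ (under σ) (under τ) φ) (subst-cong (under-∘ σ τ) φ))

substᵗ-var : ∀ t → substᵗ var t ≡ t
substᵗ-var (var i) = refl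
substᵗ-var 𝟘       = refl
substᵗ-var (𝗌 t)   = cong 𝗌 (substᵗ-var t)
substᵗ-var (s ⊕ t) = cong₂ _⊕_ (substᵗ-var s) (substᵗ-var t)
substᵗ-var (s ⊗ t) = cong₂ _⊗_ (substᵗ-var s) (substᵗ-var t)

under-id : under var ≗ var
under-id zero    = refl
under-id (suc i) = refl

subst-var : ∀ φ → subst var φ ≡ φ
subst-var (s ≐ t) = cong₂ _≐_ (substᵗ-var s) (substᵗ-var t)
subst-var (s ≼ t) = cong₂ _≼_ (substᵗ-var s) (substᵗ-var t)
subst-var ⊥̇       = refl
subst-var (φ ⇒ ψ) = cong₂ _⇒_ (subst-var φ) (subst-var ψ)
subst-var (φ ∧̇ ψ) = cong₂ _∧̇_ (subst-var φ) (subst-var ψ)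
subst-var (φ ∨̇ ψ) = cong₂ _∨̇_ (subst-var φ) (subst-var ψ)
subst-var (∀̇ φ)   = cong ∀̇_ (trans (subst-cong under-id φ) (subst-var φ))
subst-var (∃̇ φ)   = cong ∃̇_ (trans (subst-cong under-id φ) (subst-var φ))

subst-under-[] : ∀ σ φ t → subst (under σ) φ [ t ] ≡ subst (t ∙ σ) φ
subst-under-[] σ φ t = trans (subst-∘ (instantiate t) (under σ) φ) (subst-cong pointwise φ)
  where
  pointwise : substᵗ (instantiate t) ∘ under σ ≗ t ∙ σ
  pointwise zero    = refl
  pointwise (suc i) = trans (substᵗ-∘ (instantiate t) shift (σ i)) (substᵗ-var (σ i))

substᵗ-numeral : ∀ σ n → substᵗ σ (numeral n) ≡ numeral n
substᵗ-numeral σ zero    = refl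
substᵗ-numeral σ (suc n) = cong 𝗌 (substᵗ-numeral σ n)

-- Derived rules of the calculus

weaken : Γ ⊆ Δ → U ∣ Γ ⊢ φ → U ∣ Δ ⊢ φ
weaken i (axiom a)   = axiom a
weaken i (hyp h)     = hyp (i h)
weaken i (raa d)     = raa (weaken (∷⁺ʳ _ i) d)
weaken i (⇒I d)      = ⇒I (weaken (∷⁺ʳ _ i) d)
weaken i (⇒E d e)    = ⇒E (weaken i d) (weaken i e)
weaken i (∧I d e)    = ∧I (weaken i d) (weaken i e)
weaken i (∧E₁ d)     = ∧E₁ (weaken i d)
weaken i (∧E₂ d)     = ∧E₂ (weaken i d)
weaken i (∨I₁ d)     = ∨I₁ (weaken i d)
weaken i (∨I₂ d)     = ∨I₂ (weaken i d)
weaken i (∨E d e f)  = ∨E (weaken i d) (weaken (∷⁺ʳ _ i) e) (weaken (∷⁺ʳ _ i) f)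
weaken i (∀I d)      = ∀I (weaken (map⁺ _ i) d)
weaken i (∀E t d)    = ∀E t (weaken i d)
weaken i (∃I t d)    = ∃I t (weaken i d)
weaken i (∃E d e)    = ∃E (weaken i d) (weaken (∷⁺ʳ _ (map⁺ _ i)) e)
weaken i (≐refl t)   = ≐refl t
weaken i (≐E φ d e)  = ≐E φ (weaken i d) (weaken i e)

closed : U ⊢ φ → U ∣ Γ ⊢ φ
closed = weaken λ ()

_∼_ : U ∣ Γ ⊢ φ → φ ≡ ψ → U ∣ Γ ⊢ ψ
d ∼ e = ≡.subst (_ ∣ _ ⊢_) e d

hyp₀ : U ∣ φ ∷ Γ ⊢ φ
hyp₀ = hyp (here refl)

hyp₁ : U ∣ φ ∷ ψ ∷ Γ ⊢ ψ
hyp₁ = hyp (there (here refl))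

⊥E : U ∣ Γ ⊢ ⊥̇ → U ∣ Γ ⊢ φ
⊥E d = raa (weaken there d)

⇒-trans : U ∣ Γ ⊢ φ ⇒ ψ → U ∣ Γ ⊢ ψ ⇒ χ → U ∣ Γ ⊢ φ ⇒ χ
⇒-trans d e = ⇒I (⇒E (weaken there e) (⇒E (weaken there d) hyp₀))

⇔-trans : U ∣ Γ ⊢ φ ⇔̇ ψ → U ∣ Γ ⊢ ψ ⇔̇ χ → U ∣ Γ ⊢ φ ⇔̇ χ
⇔-trans d e = ∧I (⇒-trans (∧E₁ d) (∧E₁ e)) (⇒-trans (∧E₂ e) (∧E₂ d))

¬-cong : U ∣ Γ ⊢ φ ⇔̇ ψ → U ∣ Γ ⊢ ¬̇ φ ⇔̇ ¬̇ ψ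
¬-cong d = ∧I (⇒I (⇒-trans (weaken there (∧E₂ d)) hyp₀)) (⇒I (⇒-trans (weaken there (∧E₁ d)) hyp₀))

∀E-under : ∀ σ φ t → U ∣ Γ ⊢ ∀̇ subst (under σ) φ → U ∣ Γ ⊢ subst (t ∙ σ) φ
∀E-under σ φ t d = ∀E t d ∼ subst-under-[] σ φ t

∃I-under : ∀ σ φ t → U ∣ Γ ⊢ subst (t ∙ σ) φ → U ∣ Γ ⊢ ∃̇ subst (under σ) φ
∃I-under σ φ t d = ∃I t (d ∼ sym (subst-under-[] σ φ t))

∀∀E : ∀ φ s t → U ∣ Γ ⊢ ∀̇ (∀̇ φ) → U ∣ Γ ⊢ subst (t ∙ instantiate s) φ
∀∀E φ s t d = ∀E-under (instantiate s) φ t (∀E s d)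

-- Rewriting in a template: σ fills the other variables of φ at the same time, so the congruence
-- rules follow from formulas in variables alone, without shifting the terms plugged in.
leibniz : ∀ φ σ → U ∣ Γ ⊢ s ≐ t → U ∣ Γ ⊢ subst (s ∙ σ) φ → U ∣ Γ ⊢ subst (t ∙ σ) φ
leibniz φ σ e d =
  ≐E (subst (under σ) φ) e (d ∼ sym (subst-under-[] σ φ _)) ∼ subst-under-[] σ φ _

≐sym : U ∣ Γ ⊢ s ≐ t → U ∣ Γ ⊢ t ≐ s
≐sym {s = s} e = leibniz (var 0 ≐ var 1) (s ∙ var) e (≐refl s)

≐trans : U ∣ Γ ⊢ s ≐ t → U ∣ Γ ⊢ t ≐ u → U ∣ Γ ⊢ s ≐ u
≐trans {s = s} d e = leibniz (var 1 ≐ var 0) (s ∙ var) e d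

𝗌-cong : U ∣ Γ ⊢ s ≐ t → U ∣ Γ ⊢ 𝗌 s ≐ 𝗌 t
𝗌-cong {s = s} e = leibniz (𝗌 (var 1) ≐ 𝗌 (var 0)) (s ∙ var) e (≐refl _)

⊕-cong : ∀ {s s′ t t′} → U ∣ Γ ⊢ s ≐ s′ → U ∣ Γ ⊢ t ≐ t′ → U ∣ Γ ⊢ s ⊕ t ≐ s′ ⊕ t′
⊕-cong {s = s} {s′} {t} d e =
  leibniz (var 1 ⊕ var 2 ≐ var 3 ⊕ var 0) (s ∙ t ∙ s′ ∙ var) e
    (leibniz (var 1 ⊕ var 2 ≐ var 0 ⊕ var 2) (s ∙ t ∙ var) d (≐refl _))

⊗-cong : ∀ {s s′ t t′} → U ∣ Γ ⊢ s ≐ s′ → U ∣ Γ ⊢ t ≐ t′ → U ∣ Γ ⊢ s ⊗ t ≐ s′ ⊗ t′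
⊗-cong {s = s} {s′} {t} d e =
  leibniz (var 1 ⊗ var 2 ≐ var 3 ⊗ var 0) (s ∙ t ∙ s′ ∙ var) e
    (leibniz (var 1 ⊗ var 2 ≐ var 0 ⊗ var 2) (s ∙ t ∙ var) d (≐refl _))

≼-cong : ∀ {s s′ t t′} → U ∣ Γ ⊢ s ≐ s′ → U ∣ Γ ⊢ t ≐ t′ → U ∣ Γ ⊢ s ≼ t → U ∣ Γ ⊢ s′ ≼ t′
≼-cong {s = s} {s′} {t} d e f =
  leibniz (var 1 ≼ var 0) (s′ ∙ var) e (leibniz (var 0 ≼ var 1) (t ∙ var) d f)

-- Arithmetic in PA

𝗌≢𝟘 : PA ∣ Γ ⊢ 𝗌 t ≐ 𝟘 → PA ∣ Γ ⊢ ⊥̇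
𝗌≢𝟘 = ⇒E (∀E _ (axiom s≢0))

𝗌-injective : PA ∣ Γ ⊢ 𝗌 s ≐ 𝗌 t → PA ∣ Γ ⊢ s ≐ t
𝗌-injective = ⇒E (∀∀E _ _ _ (axiom sinj))

⊕-𝟘 : ∀ t → PA ∣ Γ ⊢ t ⊕ 𝟘 ≐ t
⊕-𝟘 t = ∀E t (axiom +0)

⊕-𝗌 : ∀ s t → PA ∣ Γ ⊢ s ⊕ 𝗌 t ≐ 𝗌 (s ⊕ t)
⊕-𝗌 s t = ∀∀E _ s t (axiom +s)

⊗-𝟘 : ∀ t → PA ∣ Γ ⊢ t ⊗ 𝟘 ≐ 𝟘
⊗-𝟘 t = ∀E t (axiom ×0)

⊗-𝗌 : ∀ s t → PA ∣ Γ ⊢ s ⊗ 𝗌 t ≐ s ⊗ t ⊕ s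
⊗-𝗌 s t = ∀∀E _ s t (axiom ×s)

≼-def : ∀ s t → PA ∣ Γ ⊢ s ≼ t ⇔̇ ∃̇ (var 0 ⊕ substᵗ shift s ≐ substᵗ shift t)
≼-def s t = ∀∀E _ s t (axiom ≤def)

≼I : ∀ u → PA ∣ Γ ⊢ u ⊕ s ≐ t → PA ∣ Γ ⊢ s ≼ t
≼I {s = s} {t} u d = ⇒E (∧E₂ (≼-def s t))
  (∃I-under (t ∙ instantiate s) (var 0 ⊕ var 2 ≐ var 1) u d)

≼E : PA ∣ Γ ⊢ s ≼ t →
     PA ∣ (var 0 ⊕ substᵗ shift s ≐ substᵗ shift t) ∷ map (subst shift) Γ ⊢ subst shift χ →
     PA ∣ Γ ⊢ χ
≼E {s = s} {t} d = ∃E (⇒E (∧E₁ (≼-def s t)) d)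

𝗌≼𝗌⁻ : PA ∣ Γ ⊢ 𝗌 s ≼ 𝗌 t → PA ∣ Γ ⊢ s ≼ t
𝗌≼𝗌⁻ d = ≼E d (≼I (var 0) (𝗌-injective (≐trans (≐sym (⊕-𝗌 _ _)) hyp₀)))

𝗌≼𝗌⁺ : PA ∣ Γ ⊢ s ≼ t → PA ∣ Γ ⊢ 𝗌 s ≼ 𝗌 t
𝗌≼𝗌⁺ d = ≼E d (≼I (var 0) (≐trans (⊕-𝗌 _ _) (𝗌-cong hyp₀)))

𝗌⋠𝟘 : PA ∣ Γ ⊢ 𝗌 t ≼ 𝟘 → PA ∣ Γ ⊢ ⊥̇
𝗌⋠𝟘 d = ≼E d (𝗌≢𝟘 (≐trans (≐sym (⊕-𝗌 _ _)) hyp₀))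

𝟘≼ : ∀ t → PA ∣ Γ ⊢ 𝟘 ≼ t
𝟘≼ t = ≼I t (⊕-𝟘 t)

-- Induction, with the predecessor as witness of the successor case. No other instance of the
-- induction scheme is invoked: the facts about numerals below go by recursion outside PA.
𝟘-or-𝗌 : ∀ t → PA ∣ Γ ⊢ t ≐ 𝟘 ∨̇ ∃̇ (substᵗ shift t ≐ 𝗌 (var 0))
𝟘-or-𝗌 t = ∀E t (⇒E (axiom (ind 0 ZS ((s≤s z≤n , _) , s≤s (s≤s z≤n) , s≤s z≤n)))
  (∧I (∨I₁ (≐refl 𝟘)) (∀I (⇒I (∨I₂ (∃I (var 0) (≐refl _)))))))
  where
  ZS : Formula
  ZS = var 0 ≐ 𝟘 ∨̇ ∃̇ (var 1 ≐ 𝗌 (var 0))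

-- The order `n + m` fits both recursions: PA recurs on the right summand, `_+_` on the left one.
numeral-+ : ∀ m n → PA ∣ Γ ⊢ numeral m ⊕ numeral n ≐ numeral (n + m)
numeral-+ m zero    = ⊕-𝟘 _
numeral-+ m (suc n) = ≐trans (⊕-𝗌 _ _) (𝗌-cong (numeral-+ m n))

numeral-* : ∀ m n → PA ∣ Γ ⊢ numeral m ⊗ numeral n ≐ numeral (n * m)
numeral-* m zero    = ⊗-𝟘 _
numeral-* m (suc n) =
  ≐trans (⊗-𝗌 _ _) (≐trans (⊕-cong (numeral-* m n) (≐refl _)) (numeral-+ (n * m) m))

numeral-≢ : ∀ {m n} → m ≢ n → PA ∣ Γ ⊢ numeral m ≐ numeral n → PA ∣ Γ ⊢ ⊥̇
numeral-≢ {m = zero}  {zero}  m≢n d = ⊥-elim (m≢n refl)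
numeral-≢ {m = zero}  {suc n} m≢n d = 𝗌≢𝟘 (≐sym d)
numeral-≢ {m = suc m} {zero}  m≢n d = 𝗌≢𝟘 d
numeral-≢ {m = suc m} {suc n} m≢n d = numeral-≢ (m≢n ∘ cong suc) (𝗌-injective d)

numeral-≼ : ∀ {m n} → m ≤ n → PA ∣ Γ ⊢ numeral m ≼ numeral n
numeral-≼ z≤n     = 𝟘≼ _
numeral-≼ (s≤s p) = 𝗌≼𝗌⁺ (numeral-≼ p)

numeral-⋠ : ∀ {m n} → ¬ m ≤ n → PA ∣ Γ ⊢ numeral m ≼ numeral n → PA ∣ Γ ⊢ ⊥̇
numeral-⋠ {m = zero}          m≰n d = ⊥-elim (m≰n z≤n)
numeral-⋠ {m = suc m} {zero}  m≰n d = 𝗌⋠𝟘 d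
numeral-⋠ {m = suc m} {suc n} m≰n d = numeral-⋠ (m≰n ∘ s≤s) (𝗌≼𝗌⁻ d)

-- Recursion on the numeral outside PA, with a case split on t inside PA. It is the comparison of
-- witnesses in `graph-functional`.
≼-numeral-total : ∀ n t → PA ∣ Γ ⊢ t ≼ numeral n ∨̇ numeral n ≼ t
≼-numeral-total zero    t = ∨I₂ (𝟘≼ t)
≼-numeral-total (suc n) t = ∨E (𝟘-or-𝗌 t)
  (∨I₁ (≼-cong (≐sym hyp₀) (≐refl _) (𝟘≼ _)))
  (∃E hyp₀ (∨E (≼-numeral-total n (var 0))
    (∨I₁ (≼-cong (≐sym hyp₁) (≐refl _) (𝗌≼𝗌⁺ hyp₀)
           ∼ cong (substᵗ shift t ≼_) (sym (substᵗ-numeral shift (suc n)))))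
    (∨I₂ (≼-cong (≐refl _) (≐sym hyp₁) (𝗌≼𝗌⁺ hyp₀)
           ∼ cong (_≼ substᵗ shift t) (sym (substᵗ-numeral shift (suc n)))))))

Valuation : Set
Valuation = ℕ → ℕ

infixr 20 _▹_

_▹_ : ℕ → Valuation → Valuation
(x ▹ ρ) zero    = x
(x ▹ ρ) (suc i) = ρ i

numerals : Valuation → Substitution
numerals ρ i = numeral (ρ i)

subst-▹ : ∀ x ρ φ → subst (numerals (x ▹ ρ)) φ ≡ subst (numeral x ∙ numerals ρ) φ
subst-▹ x ρ = subst-cong λ { zero → refl ; (suc i) → refl }

-- This replaces the provable disjunction t = 0 ∨ ... ∨ t = n by its elimination rule.
≼-numeral-elim : ∀ n ρ χ → (∀ i → i ≤ n → PA ⊢ subst (numeral i ∙ numerals ρ) χ) →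
                 ∀ t → PA ∣ Γ ⊢ t ≼ numeral n → PA ∣ Γ ⊢ subst (t ∙ numerals ρ) χ
≼-numeral-elim n ρ χ d t t≼n = ⇒E (⇒I (∨E (𝟘-or-𝗌 t)
  (leibniz χ (numerals ρ) (≐sym hyp₀) (closed (d 0 z≤n)))
  (∃E hyp₀ (leibniz χ (numerals ρ) (≐sym hyp₀) (predecessor n d (≼-cong hyp₀ (≐refl _)
      (hyp (there (there (here refl))) ∼ cong (substᵗ shift t ≼_) (substᵗ-numeral shift n))))
    ∼ trans (subst-cong shift-closed χ) (sym (subst-∘ shift _ χ)))))) t≼n
  where
  shift-closed : substᵗ shift t ∙ numerals ρ ≗ substᵗ shift ∘ (t ∙ numerals ρ)
  shift-closed zero    = refl
  shift-closed (suc i) = sym (substᵗ-numeral shift (ρ i))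

  subst-𝗌 : ∀ s → subst (s ∙ numerals ρ) (subst successor χ) ≡ subst (𝗌 s ∙ numerals ρ) χ
  subst-𝗌 s = trans (subst-∘ _ successor χ) (subst-cong (λ { zero → refl ; (suc i) → refl }) χ)

  predecessor : ∀ n → (∀ i → i ≤ n → PA ⊢ subst (numeral i ∙ numerals ρ) χ) →
                PA ∣ Δ ⊢ 𝗌 (var 0) ≼ numeral n → PA ∣ Δ ⊢ subst (𝗌 (var 0) ∙ numerals ρ) χ
  predecessor zero    d 𝗌≼𝟘 = ⊥E (𝗌⋠𝟘 𝗌≼𝟘)
  -- The recursion continues at the predecessor, with χ(x + 1) in place of χ(x).
  predecessor (suc n) d 𝗌≼𝗌 =
    ≼-numeral-elim n ρ (subst successor χ) (λ i i≤n → d (suc i) (s≤s i≤n) ∼ sym (subst-𝗌 _))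
      (var 0) (𝗌≼𝗌⁻ 𝗌≼𝗌)
    ∼ subst-𝗌 (var 0)

-- Δ₀ formulas

eval : Valuation → Term → ℕ
eval ρ (var i) = ρ i
eval ρ 𝟘       = 0
eval ρ (𝗌 t)   = suc (eval ρ t)
eval ρ (s ⊕ t) = eval ρ s + eval ρ t
eval ρ (s ⊗ t) = eval ρ s * eval ρ t

Sat : Valuation → Formula → Set
Sat ρ (s ≐ t) = eval ρ s ≡ eval ρ t
Sat ρ (s ≼ t) = eval ρ s ≤ eval ρ t
Sat ρ ⊥̇       = ⊥
Sat ρ (φ ⇒ ψ) = Sat ρ φ → Sat ρ ψ
Sat ρ (φ ∧̇ ψ) = Sat ρ φ × Sat ρ ψ
Sat ρ (φ ∨̇ ψ) = Sat ρ φ ⊎ Sat ρ ψ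
Sat ρ (∀̇ φ)   = ∀ x → Sat (x ▹ ρ) φ
Sat ρ (∃̇ φ)   = ∃[ x ] Sat (x ▹ ρ) φ

eval-shift : ∀ x ρ t → eval (x ▹ ρ) (substᵗ shift t) ≡ eval ρ t
eval-shift x ρ (var i) = refl
eval-shift x ρ 𝟘       = refl
eval-shift x ρ (𝗌 t)   = cong suc (eval-shift x ρ t)
eval-shift x ρ (s ⊕ t) = cong₂ _+_ (eval-shift x ρ s) (eval-shift x ρ t)
eval-shift x ρ (s ⊗ t) = cong₂ _*_ (eval-shift x ρ s) (eval-shift x ρ t)

≐-eval : ∀ ρ t → PA ∣ Γ ⊢ substᵗ (numerals ρ) t ≐ numeral (eval ρ t)
≐-eval ρ (var i) = ≐refl _
≐-eval ρ 𝟘       = ≐refl _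
≐-eval ρ (𝗌 t)   = 𝗌-cong (≐-eval ρ t)
≐-eval ρ (s ⊕ t) = ≐trans (⊕-cong (≐-eval ρ s) (≐-eval ρ t))
  (numeral-+ _ (eval ρ t)
   ∼ cong (numeral (eval ρ s) ⊕ numeral (eval ρ t) ≐_) (cong numeral (+-comm (eval ρ t) (eval ρ s))))
≐-eval ρ (s ⊗ t) = ≐trans (⊗-cong (≐-eval ρ s) (≐-eval ρ t))
  (numeral-* _ (eval ρ t)
   ∼ cong (numeral (eval ρ s) ⊗ numeral (eval ρ t) ≐_) (cong numeral (*-comm (eval ρ t) (eval ρ s))))

bound-closed : ∀ ρ t → substᵗ (under (numerals ρ)) (substᵗ shift t) ≡ substᵗ (numerals ρ) t
bound-closed ρ t = trans (substᵗ-∘ _ shift t) (substᵗ-cong (λ i → substᵗ-numeral shift (ρ i)) t)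

bounded-search : {P Q : ℕ → Set} → (∀ i → P i ⊎ Q i) →
                 ∀ n → (∀ i → i ≤ n → P i) ⊎ (∃[ i ] (i ≤ n × Q i))
bounded-search dec n with dec n
bounded-search dec n       | inj₂ q = inj₂ (n , ≤-refl , q)
bounded-search dec zero    | inj₁ p = inj₁ λ { .zero z≤n → p }
bounded-search dec (suc n) | inj₁ p with bounded-search dec n
... | inj₂ (i , i≤n , q) = inj₂ (i , m≤n⇒m≤1+n i≤n , q)
... | inj₁ ps = inj₁ λ i i≤1+n → [ ps i ∘′ ≤-pred , (λ { refl → p }) ]′ (m≤n⇒m<n∨m≡n i≤1+n)

-- Truth in ℕ travels with the derivation, which lets `trueΔ₀` discard the refuted case.
Decided : Valuation → Formula → Set
Decided ρ φ = (Sat ρ φ × PA ⊢ subst (numerals ρ) φ) ⊎ (¬ Sat ρ φ × PA ⊢ ¬̇ subst (numerals ρ) φ)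

numeral-≼-bound : ∀ {x} ρ t → x ≤ eval ρ t →
                  PA ∣ Γ ⊢ numeral x ≼ substᵗ (numeral x ∙ numerals ρ) (substᵗ shift t)
numeral-≼-bound ρ t x≤t =
  ≼-cong (≐refl _) (≐sym (≐-eval ρ t)) (numeral-≼ x≤t) ∼ cong (_ ≼_) (sym (substᵗ-∘ _ shift t))

bounded-elim : ∀ ρ t φ → (∀ i → i ≤ eval ρ t → PA ⊢ subst (numerals (i ▹ ρ)) φ) →
               PA ∣ Γ ⊢ var 0 ≼ substᵗ (under (numerals ρ)) (substᵗ shift t) →
               PA ∣ Γ ⊢ subst (under (numerals ρ)) φ
bounded-elim ρ t φ d x≼t =
  ≼-numeral-elim (eval ρ t) ρ φ (λ i i≤t → d i i≤t ∼ subst-▹ i ρ φ) (var 0)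
    (≼-cong (≐refl _) (≐-eval ρ t) (x≼t ∼ cong (var 0 ≼_) (bound-closed ρ t)))
  ∼ subst-cong (λ { zero → refl ; (suc i) → sym (substᵗ-numeral shift (ρ i)) }) φ

decideΔ₀ : Δ₀ φ → ∀ ρ → Decided ρ φ
decideΔ₀ (eq s t) ρ with eval ρ s ≟ eval ρ t
... | yes e = inj₁ (e , ≐trans (≐-eval ρ s) (≐sym (≐-eval ρ t) ∼ cong (λ x → numeral x ≐ _) (sym e)))
... | no s≢t = inj₂ (s≢t , ⇒I (numeral-≢ s≢t (≐trans (≐sym (≐-eval ρ s)) (≐trans hyp₀ (≐-eval ρ t)))))
decideΔ₀ (le s t) ρ with eval ρ s ≤? eval ρ t
... | yes p = inj₁ (p , ≼-cong (≐sym (≐-eval ρ s)) (≐sym (≐-eval ρ t)) (numeral-≼ p))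
... | no s≰t = inj₂ (s≰t , ⇒I (numeral-⋠ s≰t (≼-cong (≐-eval ρ s) (≐-eval ρ t) hyp₀)))
decideΔ₀ bot ρ = inj₂ (id , ⇒I hyp₀)
decideΔ₀ (imp p q) ρ with decideΔ₀ p ρ | decideΔ₀ q ρ
... | inj₂ (f , d) | _            = inj₁ (⊥-elim ∘ f , ⇒I (⊥E (⇒E (closed d) hyp₀)))
... | inj₁ _       | inj₁ (g , e) = inj₁ ((λ _ → g) , ⇒I (closed e))
... | inj₁ (f , d) | inj₂ (g , e) = inj₂ ((λ h → g (h f)) , ⇒I (⇒E (closed e) (⇒E hyp₀ (closed d))))
decideΔ₀ (and p q) ρ with decideΔ₀ p ρ | decideΔ₀ q ρ
... | inj₂ (f , d) | _            = inj₂ (f ∘ proj₁ , ⇒I (⇒E (closed d) (∧E₁ hyp₀)))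
... | inj₁ _       | inj₂ (g , e) = inj₂ (g ∘ proj₂ , ⇒I (⇒E (closed e) (∧E₂ hyp₀)))
... | inj₁ (f , d) | inj₁ (g , e) = inj₁ ((f , g) , ∧I d e)
decideΔ₀ (or p q) ρ with decideΔ₀ p ρ | decideΔ₀ q ρ
... | inj₁ (f , d) | _            = inj₁ (inj₁ f , ∨I₁ d)
... | inj₂ _       | inj₁ (g , e) = inj₁ (inj₂ g , ∨I₂ e)
... | inj₂ (f , d) | inj₂ (g , e) =
  inj₂ ([ f , g ]′ , ⇒I (∨E hyp₀ (⇒E (closed d) hyp₀) (⇒E (closed e) hyp₀)))
decideΔ₀ (all {φ} t p) ρ with bounded-search (λ x → decideΔ₀ p (x ▹ ρ)) (eval ρ t)
... | inj₁ h = inj₁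
  ( (λ x x≤t → proj₁ (h x (≡.subst (x ≤_) (eval-shift x ρ t) x≤t)))
  , ∀I (⇒I (bounded-elim ρ t φ (λ i i≤t → proj₂ (h i i≤t)) hyp₀)) )
... | inj₂ (x , x≤t , f , d) = inj₂
  ( (λ h → f (h x (≡.subst (x ≤_) (sym (eval-shift x ρ t)) x≤t)))
  , ⇒I (⇒E (closed (d ∼ cong ¬̇_ (subst-▹ x ρ φ)))
      (⇒E (∀E-under (numerals ρ) (var 0 ≼ substᵗ shift t ⇒ φ) (numeral x) hyp₀) (numeral-≼-bound ρ t x≤t))) )
decideΔ₀ (ex {φ} t p) ρ with bounded-search (λ x → swap (decideΔ₀ p (x ▹ ρ))) (eval ρ t)
... | inj₁ h = inj₂
  ( (λ (x , x≤t , f) → proj₁ (h x (≡.subst (x ≤_) (eval-shift x ρ t) x≤t)) f)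
  , ⇒I (∃E hyp₀ (⇒E (bounded-elim ρ t (¬̇ φ) (λ i i≤t → proj₂ (h i i≤t)) (∧E₁ hyp₀)) (∧E₂ hyp₀))) )
... | inj₂ (x , x≤t , f , d) = inj₁
  ( (x , ≡.subst (x ≤_) (sym (eval-shift x ρ t)) x≤t , f)
  , ∃I-under (numerals ρ) (var 0 ≼ substᵗ shift t ∧̇ φ) (numeral x)
      (∧I (numeral-≼-bound ρ t x≤t) (d ∼ subst-▹ x ρ φ)) )

-- This transfers to PA any Δ₀ fact checked in ℕ; the divisibility arguments on codes are thus
-- carried out in ℕ only.
trueΔ₀ : Δ₀ φ → ∀ ρ → Sat ρ φ → PA ⊢ subst (numerals ρ) φ
trueΔ₀ p ρ f with decideΔ₀ p ρ
... | inj₁ (_ , d)  = d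
... | inj₂ (¬f , _) = ⊥-elim (¬f f)

-- Coding finite sets by divisibility

-- The moduli 1 + (p + 1) b of Gödel's β function. Here (b, s) codes the set of those p whose
-- modulus divides s, so a product of moduli codes its set of indices.
modulus : ℕ → ℕ → ℕ
modulus b p = suc (suc p * b)

modulus-+ : ∀ b p e → modulus b (suc p + e) ≡ modulus b p + suc e * b
modulus-+ b p e = trans (cong (λ x → suc (x * b)) (sym (+-suc (suc p) e)))
                        (cong suc (*-distribʳ-+ b (suc p) (suc e)))

module _ {b N : ℕ} (b-divisible : ∀ e → suc e ≤ N → suc e ∣ₙ b) where

  -- A common divisor d is coprime to b, as each modulus is 1 modulo b. It divides the difference (e
  -- + 1) b, hence e + 1, hence b; so d = 1.
  modulus-coprime-< : ∀ {p q} → p < q → q ≤ N → Coprime (modulus b p) (modulus b q)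
  modulus-coprime-< {p} p<q q≤N {d} (d∣p , d∣q) with m≤n⇒∃[o]m+o≡n p<q
  ... | e , refl = coprime-to-b (∣-refl , ∣-trans d∣e (b-divisible e e≤N))
    where
    coprime-to-b : Coprime d b
    coprime-to-b {x} (x∣d , x∣b) =
      ∣1⇒≡1 (∣m+n∣m⇒∣n (≡.subst (x ∣ₙ_) (+-comm 1 _) (∣-trans x∣d d∣p)) (∣-trans x∣b (n∣m*n (suc p))))
    d∣e : d ∣ₙ suc e
    d∣e = coprime-divisor coprime-to-b
      (≡.subst (d ∣ₙ_) (*-comm (suc e) b) (∣m+n∣m⇒∣n (≡.subst (d ∣ₙ_) (modulus-+ b p e) d∣q) d∣p))
    e≤N : suc e ≤ N
    e≤N = ≤-trans (s≤s (m≤n+m e p)) q≤N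

  modulus-coprime : ∀ {p q} → p ≢ q → p ≤ N → q ≤ N → Coprime (modulus b p) (modulus b q)
  modulus-coprime {p} {q} p≢q p≤N q≤N with <-cmp p q
  ... | tri< p<q _ _ = modulus-coprime-< p<q q≤N
  ... | tri≈ _ p≡q _ = ⊥-elim (p≢q p≡q)
  ... | tri> _ _ q<p = Coprimality.sym (modulus-coprime-< q<p p≤N)

-- (x + y)² ≤ ⟪ x , y ⟫ < (x + y + 1)²
⟪,⟫-<-diagonal : ∀ {x y x′ y′} → x + y < x′ + y′ → ⟪ x , y ⟫ < ⟪ x′ , y′ ⟫
⟪,⟫-<-diagonal {x} {y} {x′} {y′} lt = ≤-trans
  (s≤s (≤-trans (+-monoʳ-≤ ((x + y) * (x + y)) (m≤m+n x y)) (m≤m+n _ (x + y))))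
  (≤-trans (≤-reflexive square) (≤-trans (*-mono-≤ lt lt) (m≤m+n _ x′)))
  where
  square : suc ((x + y) * (x + y) + (x + y) + (x + y)) ≡ suc (x + y) * suc (x + y)
  square = expand (x + y)
    where
    expand : ∀ z → suc (z * z + z + z) ≡ suc z * suc z
    expand = solve-∀

-- The consecutive squares around the code determine x + y; cancelling the square leaves x.
⟪,⟫-injective : ∀ {x y x′ y′} → ⟪ x , y ⟫ ≡ ⟪ x′ , y′ ⟫ → x ≡ x′ × y ≡ y′
⟪,⟫-injective {x} {y} {x′} {y′} e with <-cmp (x + y) (x′ + y′)
... | tri< lt _ _ = ⊥-elim (<-irrefl e (⟪,⟫-<-diagonal {x} {y} {x′} {y′} lt))
... | tri> _ _ gt = ⊥-elim (<-irrefl (sym e) (⟪,⟫-<-diagonal {x′} {y′} {x} {y} gt))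
... | tri≈ _ d _ = x≡x′ , +-cancelˡ-≡ x y y′ (trans d (cong (_+ y′) (sym x≡x′)))
  where
  x≡x′ : x ≡ x′
  x≡x′ = +-cancelˡ-≡ ((x + y) * (x + y)) x x′ (trans e (cong (λ z → z * z + x′) (sym d)))

-- The graph of the code of numerals

numeralCode : ℕ → ℕ
numeralCode n = ⌜ numeral n ⌝ᵗ

numeralCode-< : ∀ n → numeralCode n < numeralCode (suc n)
-- With c the code of numeral n, the next code unfolds to (1 + c)² + 1.
numeralCode-< n = ≤-trans (m≤m*n (suc (numeralCode n)) (suc (numeralCode n))) (m≤m+n _ 1)

numeralCode-mono : ∀ {m n} → m ≤ n → numeralCode m ≤ numeralCode n
numeralCode-mono = go ∘ ≤⇒≤′
  where
  go : ∀ {m n} → m ≤′ n → numeralCode m ≤ numeralCode n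
  go ≤′-refl     = ≤-refl
  go (≤′-step {n} p) = ≤-trans (go p) (<⇒≤ (numeralCode-< n))

n≤numeralCode : ∀ n → n ≤ numeralCode n
n≤numeralCode zero    = z≤n
n≤numeralCode (suc n) = ≤-<-trans (n≤numeralCode n) (numeralCode-< n)

graphPoint : ℕ → ℕ
graphPoint j = ⟪ j , numeralCode j ⟫

⟪,⟫-mono : ∀ {x y x′ y′} → x ≤ x′ → y ≤ y′ → ⟪ x , y ⟫ ≤ ⟪ x′ , y′ ⟫
⟪,⟫-mono p q = +-mono-≤ (*-mono-≤ (+-mono-≤ p q) (+-mono-≤ p q)) p

graphPoint-≤ : ∀ {m n} → m ≤ n → graphPoint m ≤ graphPoint n
graphPoint-≤ p = ⟪,⟫-mono p (numeralCode-mono p)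

graphCode : ℕ → ℕ → ℕ
graphCode b zero    = modulus b (graphPoint zero)
graphCode b (suc n) = modulus b (graphPoint (suc n)) * graphCode b n

∣graphCode⁺ : ∀ b {j n} → j ≤′ n → modulus b (graphPoint j) ∣ₙ graphCode b n
∣graphCode⁺ b {n = zero}  ≤′-refl     = ∣-refl
∣graphCode⁺ b {n = suc n} ≤′-refl     = m∣m*n (graphCode b n)
∣graphCode⁺ b {n = suc n} (≤′-step p) = ∣n⇒∣m*n (modulus b (graphPoint (suc n))) (∣graphCode⁺ b p)

-- If p is not the last point, its modulus is coprime to the last factor, so it divides the product
-- of the others.
∣graphCode⁻ : ∀ {b N} → (∀ e → suc e ≤ N → suc e ∣ₙ b) → 1 ≤ b → ∀ {p} → p ≤ N →
              ∀ n → graphPoint n ≤ N → modulus b p ∣ₙ graphCode b n → ∃[ j ] (j ≤ n × p ≡ graphPoint j)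
∣graphCode⁻ {b} div 1≤b {p} p≤N n gₙ≤N h with p ≟ graphPoint n
... | yes e = n , ≤-refl , e
-- A positive base makes each modulus at least 2, so none divides a number coprime to it.
∣graphCode⁻ {suc b} div 1≤b {p} p≤N zero gₙ≤N h | no p≢g
  with modulus-coprime div p≢g p≤N gₙ≤N (∣-refl , h)
... | ()
∣graphCode⁻ div 1≤b p≤N (suc n) gₙ≤N h | no p≢g
  with ∣graphCode⁻ div 1≤b p≤N n (≤-trans (graphPoint-≤ (<⇒≤ (n<1+n n))) gₙ≤N)
         (coprime-divisor (modulus-coprime div p≢g p≤N gₙ≤N) h)
... | j , j≤n , e = j , m≤n⇒m≤1+n j≤n , e

-- Representing numeralCode

pair : Term → Term → Term
pair s t = (s ⊕ t) ⊗ (s ⊕ t) ⊕ s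

-- The arguments of Member, Chain and Witness are variable indices.  A pair (b, s) codes
-- the finite relation { (i, v) ∣ modulus b ⟪ i , v ⟫ divides s }; Chain says that, up to y,
-- this relation is contained in the graph of numeralCode, each of its points other than
-- (0, 0) being the successor of another one.
Member : (i v b s : ℕ) → Formula
Member i v b s = ∃̇ (var 0 ≼ var (1 + s) ∧̇
  var 0 ⊗ 𝗌 (𝗌 (pair (var (1 + i)) (var (1 + v))) ⊗ var (1 + b)) ≐ var (1 + s))

Chain : (y b s : ℕ) → Formula
Chain y b s = ∀̇ (var 0 ≼ var (1 + y) ⇒ ∀̇ (var 0 ≼ var (2 + y) ⇒ (Member 1 0 (2 + b) (2 + s) ⇒
  (var 1 ≐ 𝟘 ∧̇ var 0 ≐ 𝟘) ∨̇
  ∃̇ (var 0 ≼ var 2 ∧̇ ∃̇ (var 0 ≼ var 2 ∧̇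
    (var 3 ≐ 𝗌 (var 1) ∧̇ (var 2 ≐ pair (𝗌 𝟘) (var 0) ∧̇ Member 1 0 (4 + b) (4 + s))))))))

Witness : (w y x : ℕ) → Formula
Witness w y x = ∃̇ (var 0 ≼ var (1 + w) ∧̇ ∃̇ (var 0 ≼ var (2 + w) ∧̇
  (var (2 + x) ≼ var (2 + y) ∧̇ (Member (2 + x) (2 + y) 1 0 ∧̇ Chain (2 + y) 1 0))))

memberΔ₀ : ∀ i v b s → Δ₀ (Member i v b s)
memberΔ₀ i v b s = ex (var s) (eq _ _)

witnessΔ₀ : ∀ w y x → Δ₀ (Witness w y x)
witnessΔ₀ w y x = ex (var w) (ex (var (1 + w)) (and (le _ _) (and (memberΔ₀ (2 + x) (2 + y) 1 0)
  (all (var (2 + y)) (all (var (3 + y)) (imp (memberΔ₀ 1 0 3 2)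
    (or (and (eq _ _) (eq _ _))
        (ex (var 1) (ex (var 1) (and (eq _ _) (and (eq _ _) (memberΔ₀ 1 0 5 4))))))))))))

-- Descent on i: each coded point other than (0, 0) comes from one with first coordinate i - 1, and
-- ⟪ 1 , v′ ⟫ is the code of a successor whose argument has code v′.
chain-sound : ∀ ρ y b s → Sat ρ (Chain y b s) → ∀ i v → i ≤ ρ y → v ≤ ρ y →
              Sat (v ▹ i ▹ ρ) (Member 1 0 (2 + b) (2 + s)) → v ≡ numeralCode i
chain-sound ρ y b s chain i v i≤y v≤y m with chain i i≤y v v≤y m
... | inj₁ (refl , refl) = refl
chain-sound ρ y b s chain (suc i) v i≤y v≤y m | inj₂ (.i , _ , v′ , v′≤v , refl , v≡ , m′) =
  trans v≡ (cong ⟪ 1 ,_⟫ (chain-sound ρ y b s chain i v′ (<⇒≤ i≤y) (≤-trans v′≤v v≤y) m′))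

-- The clause x ≤ y of `Witness` places the point (x, y) in the square that `Chain` controls.
witness-sound : ∀ ρ w y x → Sat ρ (Witness w y x) → ρ y ≡ numeralCode (ρ x)
witness-sound ρ w y x (b , _ , s , _ , x≤y , m , chain) =
  chain-sound (s ▹ b ▹ ρ) (2 + y) 1 0 chain (ρ x) (ρ y) x≤y ≤-refl m

suc∣! : ∀ N e → suc e ≤ N → suc e ∣ₙ N !
suc∣! N e e<N = ∣-trans (m∣m*n (e !)) (m≤n⇒m!∣n! e<N)

member⁺ : ∀ {m s} → suc m ∣ₙ s → ∃[ q ] (q ≤ s × q * suc m ≡ s)
member⁺ {m} (divides q refl) = q , m≤m*n q (suc m) , refl

-- The code is the product of the moduli of the graph points up to n. The bound N = ⟪ y , y ⟫ covers
-- all pairs inspected by `Chain`, and the base N! is divisible by all of 1, ..., N, so their moduli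
-- are pairwise coprime and no pair off the graph gets in.
witness-complete : ∀ n → ∃[ w ] (numeralCode n ≤ w ×
                   (∀ ρ → Sat (w ▹ numeralCode n ▹ n ▹ ρ) (Witness 0 1 2)))
-- The sum bounds base, code and value at once.
witness-complete n = base + code + y , m≤n+m y (base + code) , λ ρ →
    base , ≤-trans (m≤m+n base code) (m≤m+n (base + code) y)
  , code , ≤-trans (m≤n+m code base) (m≤m+n (base + code) y)
  , n≤numeralCode n
  , member⁺ (∣graphCode⁺ base {j = n} ≤′-refl)
  , λ i i≤y v v≤y (q , _ , e) → chain i v (∣graphCode⁻ (suc∣! N) (1≤n! N) (⟪,⟫-mono i≤y v≤y) n
      (⟪,⟫-mono (n≤numeralCode n) ≤-refl) (divides q (sym e)))
  where
  y N base code : ℕ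
  y = numeralCode n
  N = ⟪ y , y ⟫
  base = N !
  code = graphCode base n
  chain : ∀ i v → ∃[ j ] (j ≤ n × ⟪ i , v ⟫ ≡ graphPoint j) →
    (i ≡ 0 × v ≡ 0) ⊎ (∃[ i′ ] (i′ ≤ i × ∃[ v′ ] (v′ ≤ v × (i ≡ suc i′ × (v ≡ ⟪ 1 , v′ ⟫ ×
      ∃[ q ] (q ≤ code × q * modulus base ⟪ i′ , v′ ⟫ ≡ code))))))
  chain i v (j , j≤n , e) with ⟪,⟫-injective {i} {v} {j} {numeralCode j} e
  chain i v (zero  , j≤n , e) | refl , refl = inj₁ (refl , refl)
  chain i v (suc j , j≤n , e) | refl , refl = inj₂ (j , <⇒≤ (n<1+n j) , numeralCode j ,
    <⇒≤ (numeralCode-< j) , refl , refl , member⁺ (∣graphCode⁺ base (≤⇒≤′ (<⇒≤ j≤n))))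

-- Variables are read as in `Graph`. The quantifiers range over w′ ≤ w and y′ ≤ w′, which keeps the
-- formula Δ₀; the second bound matches the first conjunct of `Graph`.
Unique : Formula
Unique = ∀̇ (var 0 ≼ var 1 ⇒ ∀̇ (var 0 ≼ var 1 ⇒ (Witness 1 0 4 ⇒ var 0 ≐ var 3)))

-- Variables 0, 1, 2 are the witness w, the value y and the argument x.  As in Rosser's
-- argument, comparing w with a numeral witness makes PA prove that y is unique.
Graph : Formula
Graph = var 1 ≼ var 0 ∧̇ (Witness 0 1 2 ∧̇ Unique)

graphΔ₀ : Δ₀ Graph
graphΔ₀ = and (le _ _) (and (witnessΔ₀ 0 1 2)
  (all (var 0) (all (var 0) (imp (witnessΔ₀ 1 0 4) (eq _ _)))))

unique-elim : ∀ σ a b → PA ∣ Γ ⊢ subst σ Unique → PA ∣ Γ ⊢ a ≼ σ 0 → PA ∣ Γ ⊢ b ≼ a →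
              PA ∣ Γ ⊢ subst (a ∙ b ∙ σ 2 ∙ var) (Witness 0 1 2) → PA ∣ Γ ⊢ b ≐ σ 1
unique-elim σ a b d a≼w b≼a e =
  ⇒E (⇒E (∀E-under (a ∙ σ) (var 0 ≼ var 1 ⇒ (Witness 1 0 4 ⇒ var 0 ≐ var 3)) b
    (⇒E (∀E-under σ (var 0 ≼ var 1 ⇒ ∀̇ (var 0 ≼ var 1 ⇒ (Witness 1 0 4 ⇒ var 0 ≐ var 3))) a d) a≼w)) b≼a) e

-- `Graph` is true in ℕ at a standard witness: `witness-complete` supplies the witness and
-- `witness-sound` its uniqueness clause.
graph-total : ∀ n → ∃[ w ] (∀ σ → PA ⊢ subst (numeral w ∙ numeral (numeralCode n) ∙ numeral n ∙ σ) Graph)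
graph-total n with witness-complete n
... | w , y≤w , wit = w , λ σ → trueΔ₀ graphΔ₀ ρ (y≤w , wit (λ _ → 0) , λ w′ _ y′ _ wit′ →
    witness-sound (y′ ▹ w′ ▹ ρ) 1 0 4 wit′)
  where
  ρ : Valuation
  -- The tail is an arbitrary default: only variables 0, 1, 2 are free in `Graph`, so the derivation
  -- fits every σ by computation.
  ρ = w ▹ numeralCode n ▹ n ▹ λ _ → 0

-- If σ 0 ≤ w, the uniqueness clause of the standard instance applies to the given one; if w ≤ σ 0,
-- the roles are exchanged.
graph-functional : ∀ σ n → σ 2 ≡ numeral n → PA ∣ Γ ⊢ subst σ Graph → PA ∣ Γ ⊢ σ 1 ≐ numeral (numeralCode n)
graph-functional σ n σ₂ d with graph-total n
... | w , e = ∨E (≼-numeral-total w (σ 0))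
  (unique-elim (numeral w ∙ numeral (numeralCode n) ∙ numeral n ∙ var) (σ 0) (σ 1)
    (∧E₂ (∧E₂ (closed (e var)))) hyp₀ (∧E₁ (weaken there d))
    (∧E₁ (∧E₂ (weaken there d)) ∼ cong (λ x → subst (σ 0 ∙ σ 1 ∙ x ∙ var) (Witness 0 1 2)) σ₂))
  (≐sym (unique-elim σ (numeral w) (numeral (numeralCode n))
    (∧E₂ (∧E₂ (weaken there d))) hyp₀ (∧E₁ (closed (e var)))
    (∧E₁ (∧E₂ (closed (e var)))
     ∼ cong (λ x → subst (numeral w ∙ numeral (numeralCode n) ∙ x ∙ var) (Witness 0 1 2)) (sym σ₂))))

-- Diagonalisation

-- Variable 0 of ψ receives the code of the numeral of x, and variable 1 receives x itself. The
-- inner quantifier binds the witness of `Graph`, for which the shift makes room.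
Compose : Formula → Formula
Compose ψ = ∃̇ (∃̇ (Graph ∧̇ subst shift ψ))

-- Functionality of `Graph` gives the forward direction, totality the converse.
compose-correct : ∀ ψ n →
  PA ⊢ Compose ψ [ numeral n ] ⇔̇ subst (numeral (numeralCode n) ∙ instantiate (numeral n)) ψ
compose-correct ψ n = ∧I
  (⇒I (∃E hyp₀ (∃E hyp₀
    (leibniz ψ (λ i → σ₂ (2 + i)) (graph-functional σ₂ n σ₂-arg (∧E₁ hyp₀))
       (∧E₂ hyp₀ ∼ subst-∘ σ₂ shift ψ ∼ subst-cong head ψ)
     ∼ trans (subst-cong result ψ) (sym (trans (cong (subst shift) (subst-∘ shift _ ψ)) (subst-∘ shift _ ψ)))))))
  (⇒I (∃I-under (instantiate (numeral n)) (∃̇ (Graph ∧̇ subst shift ψ)) value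
    (∃I-under (value ∙ instantiate (numeral n)) (Graph ∧̇ subst shift ψ) (numeral w)
      (∧I (closed (proj₂ (graph-total n) var)) (hyp₀ ∼ sym (subst-∘ _ shift ψ))))))
  where
  value : Term
  value = numeral (numeralCode n)
  w : ℕ
  w = proj₁ (graph-total n)
  σ₂ : Substitution
  σ₂ = under (under (instantiate (numeral n)))
  σ₂-arg : σ₂ 2 ≡ numeral n
  σ₂-arg = trans (cong (substᵗ shift) (substᵗ-numeral shift n)) (substᵗ-numeral shift n)
  head : substᵗ σ₂ ∘ shift ≗ var 1 ∙ (λ i → σ₂ (2 + i))
  head zero    = refl
  head (suc i) = refl
  result : value ∙ (λ i → σ₂ (2 + i)) ≗
           substᵗ shift ∘ substᵗ shift ∘ (value ∙ instantiate (numeral n))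
  result zero    = sym (trans (cong (substᵗ shift) (substᵗ-numeral shift (numeralCode n)))
                              (substᵗ-numeral shift (numeralCode n)))
  result (suc i) = refl

-- Wrap n θ is equivalent to θ [ numeral n ], but its Gödel number is a polynomial in
-- numeralCode n and gödel θ.
Wrap : ℕ → Formula → Formula
Wrap n θ = ∃̇ (var 0 ≐ numeral n ∧̇ θ)

-- The tags 7, 4, 0 are those of ∃, ∧ and ≐ in `gödel`; the pair of 4 and 0 codes variable 0.
wrapCode : Term → Term → Term
wrapCode s t = pair (numeral 7) (pair (numeral 4)
  (pair (pair (numeral 0) (pair (pair (numeral 4) (numeral 0)) s)) t))

pair-numeral : ∀ {s t a b} → PA ∣ Γ ⊢ s ≐ numeral a → PA ∣ Γ ⊢ t ≐ numeral b →
               PA ∣ Γ ⊢ pair s t ≐ numeral ⟪ a , b ⟫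
pair-numeral {a = a} {b} d e =
  ≐trans (⊕-cong (⊗-cong (⊕-cong d e) (⊕-cong d e)) d) (≐-eval (a ▹ b ▹ λ _ → 0) (pair (var 0) (var 1)))

pair-⌜∃⌝ : ∀ φ → PA ∣ Γ ⊢ t ≐ ⌜ φ ⌝ → PA ∣ Γ ⊢ pair (numeral 7) t ≐ ⌜ ∃̇ φ ⌝
pair-⌜∃⌝ φ = pair-numeral (≐refl (numeral 7))

pair-⌜∧⌝ : ∀ φ ψ → PA ∣ Γ ⊢ s ≐ ⌜ φ ⌝ → PA ∣ Γ ⊢ t ≐ ⌜ ψ ⌝ →
           PA ∣ Γ ⊢ pair (numeral 4) (pair s t) ≐ ⌜ φ ∧̇ ψ ⌝
pair-⌜∧⌝ φ ψ d e = pair-numeral (≐refl (numeral 4)) (pair-numeral d e)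

pair-⌜≐⌝ : ∀ a b → PA ∣ Γ ⊢ s ≐ numeral ⌜ a ⌝ᵗ → PA ∣ Γ ⊢ t ≐ numeral ⌜ b ⌝ᵗ →
           PA ∣ Γ ⊢ pair (numeral 0) (pair s t) ≐ ⌜ a ≐ b ⌝
pair-⌜≐⌝ a b d e = pair-numeral (≐refl (numeral 0)) (pair-numeral d e)

wrapCode-correct : ∀ n θ →
  PA ∣ Γ ⊢ wrapCode (numeral (numeralCode n)) (numeral (gödel θ)) ≐ ⌜ Wrap n θ ⌝
wrapCode-correct n θ = pair-⌜∃⌝ (var 0 ≐ numeral n ∧̇ θ) (pair-⌜∧⌝ (var 0 ≐ numeral n) θ
  (pair-⌜≐⌝ (var 0) (numeral n) (pair-numeral (≐refl (numeral 4)) (≐refl (numeral 0))) (≐refl _))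
  (≐refl _))

wrap-⇔ : ∀ n θ → U ⊢ Wrap n θ ⇔̇ θ [ numeral n ]
wrap-⇔ n θ = ∧I
  (⇒I (∃E hyp₀ (leibniz θ shift (∧E₁ hyp₀) (∧E₂ hyp₀ ∼ sym (trans (subst-cong head θ) (subst-var θ)))
    ∼ trans (subst-cong result θ) (sym (subst-∘ shift _ θ)))))
  (⇒I (∃I (numeral n) (∧I (≐refl _ ∼ cong (numeral n ≐_) (sym (substᵗ-numeral _ n))) hyp₀)))
  where
  head : var 0 ∙ shift ≗ var
  head zero    = refl
  head (suc i) = refl
  result : numeral n ∙ shift ≗ substᵗ shift ∘ instantiate (numeral n)
  result zero    = sym (substᵗ-numeral shift n)
  result (suc i) = refl

-- φ composed with n ↦ `gödel (Wrap n θ)`, where g denotes the Gödel number of θ: a constant when θ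
-- is fixed, or variable 1 when n is itself that number.
Pullback : Term → Formula → Formula
Pullback g φ = Compose (subst (wrapCode (var 0) g ∙ λ i → var (2 + i)) φ)

pullback-correct : ∀ g φ n θ →
  substᵗ (numeral (numeralCode n) ∙ instantiate (numeral n)) g ≡ numeral (gödel θ) →
  PA ⊢ Pullback g φ [ numeral n ] ⇔̇ φ [ ⌜ Wrap n θ ⌝ ]
pullback-correct g φ n θ g≡ = ⇔-trans (compose-correct _ n) (∧I
  (⇒I (leibniz φ var (wrapCode-correct n θ) (hyp₀ ∼ trans (subst-∘ κ _ φ) (subst-cong inner φ))
    ∼ subst-cong outer φ))
  (⇒I (leibniz φ var (≐sym (wrapCode-correct n θ)) (hyp₀ ∼ sym (subst-cong outer φ))
    ∼ sym (trans (subst-∘ κ _ φ) (subst-cong inner φ)))))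
  where
  κ : Substitution
  κ = numeral (numeralCode n) ∙ instantiate (numeral n)
  inner : substᵗ κ ∘ (wrapCode (var 0) g ∙ λ i → var (2 + i)) ≗
          wrapCode (numeral (numeralCode n)) (numeral (gödel θ)) ∙ var
  inner zero    = cong (wrapCode (numeral (numeralCode n))) g≡
  inner (suc i) = refl
  outer : ⌜ Wrap n θ ⌝ ∙ var ≗ instantiate ⌜ Wrap n θ ⌝
  outer zero    = refl
  outer (suc i) = refl

abstract
  -- The diagonal lemma: for θ = `Pullback (var 1) φ`, the instance of θ at its own Gödel number is
  -- equivalent both to G = `Wrap (gödel θ) θ` and to φ at the code of G.
  fixedPoint : ∀ φ → ∃[ G ] (PA ⊢ G ⇔̇ φ [ ⌜ G ⌝ ])
  fixedPoint φ = _ , fixed (Pullback (var 1) φ) refl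
    where
    -- θ is a variable here lest its Gödel number be unfolded in unary.
    fixed : ∀ θ → θ ≡ Pullback (var 1) φ → PA ⊢ Wrap (gödel θ) θ ⇔̇ φ [ ⌜ Wrap (gödel θ) θ ⌝ ]
    fixed θ e = ⇔-trans (wrap-⇔ (gödel θ) θ ∼ cong (λ χ → Wrap (gödel θ) θ ⇔̇ χ [ ⌜ θ ⌝ ]) e)
      (pullback-correct (var 1) φ (gödel θ) θ refl)

-- Iterates of the provability predicate

module _ (Pr : Formula) where

  -- A counterpart of `iterate` with `Wrap` for substitution, so that PA can compute its code.
  -- Building from the inside matches the composition of pullbacks in `notWrapped`.
  wrapped : ℕ → Formula → Formula
  wrapped zero    ψ = ψ
  wrapped (suc j) ψ = wrapped j (Wrap (gödel ψ) Pr)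

  notWrapped : ℕ → Formula
  notWrapped zero    = ¬̇ Pr
  notWrapped (suc j) = Pullback (numeral (gödel Pr)) (notWrapped j)

  notWrapped-correct : ∀ j ψ → PA ⊢ notWrapped j [ ⌜ ψ ⌝ ] ⇔̇ ¬̇ Pr [ ⌜ wrapped j ψ ⌝ ]
  notWrapped-correct zero    ψ = ∧I (⇒I hyp₀) (⇒I hyp₀)
  notWrapped-correct (suc j) ψ = ⇔-trans
    (pullback-correct (numeral (gödel Pr)) (notWrapped j) (gödel ψ) Pr (substᵗ-numeral _ (gödel Pr)))
    (notWrapped-correct j (Wrap (gödel ψ) Pr))

  diagonal : ∀ j → ∃[ G ] (PA ⊢ G ⇔̇ ¬̇ Pr [ ⌜ wrapped j G ⌝ ])
  diagonal j = _ , ⇔-trans (proj₂ (fixedPoint (notWrapped j))) (notWrapped-correct j _)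

  iterate-+ : ∀ m n φ → iterate Pr m (iterate Pr n φ) ≡ iterate Pr (m + n) φ
  iterate-+ zero    n φ = refl
  iterate-+ (suc m) n φ = cong (λ ψ → Pr [ ⌜ ψ ⌝ ]) (iterate-+ m n φ)

  iterate-suc : ∀ m φ → iterate Pr m (Pr [ ⌜ φ ⌝ ]) ≡ iterate Pr (suc m) φ
  iterate-suc m φ = trans (iterate-+ m 1 φ) (cong (λ i → iterate Pr i φ) (+-comm m 1))

  -- Instances of D3 at the iterates of φ compose: the one at the (j k)-th iterate leads from n + j
  -- k to n + k + j k occurrences of Pr.
  D3-multiple : ∀ {S n k} → D3 n (n + k) S Pr → ∀ j → D3 n (n + j * k) S Pr
  D3-multiple {n = n} d3 zero φ = ⇒I hyp₀ ∼ cong (λ i → iterate Pr n φ ⇒ iterate Pr i φ) (sym (+-identityʳ n))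
  D3-multiple {n = n} {k} d3 (suc j) φ = ⇒-trans (D3-multiple {n = n} {k} d3 j φ)
    (d3 (iterate Pr (j * k) φ) ∼ cong₂ _⇒_ (iterate-+ n (j * k) φ)
      (trans (iterate-+ (n + k) (j * k) φ) (cong (λ i → iterate Pr i φ) (+-assoc n k (j * k)))))

-- Unprovability of consistency

corollary2p12 : (S T : Theory) →
    ConsistentCEExtensionOfPA S → ConsistentCEExtensionOfPA T → S ⊑ T →
    (n k : ℕ) → n ≥ 1 → k ≥ 1 →
    (Pr : Formula) → Σ₁ Pr → IsProvabilityPredicate S T Pr →
    E S T Pr → C S Pr → D3 n (n + k) S Pr →
    T ⊬ Con Pr
corollary2p12 S T _ T-ext S⊑T n@(suc n-1) k@(suc k-1) n≥1 k≥1 Pr _ isPr extensional conjunctive d3 con =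
  consistent (⇒E ¬PrⁿG (necessitation* n G-provable))
  where
  open ConsistentCEExtensionOfPA T-ext
  open IsProvabilityPredicate isPr

  necessitation* : ∀ i → T ⊢ φ → T ⊢ iterate Pr i φ
  necessitation* zero    d = d
  necessitation* (suc i) d = S⊑T _ (Equivalence.to (correct _) (necessitation* i d))

  -- A refutable φ is equivalent in T to 0 = 1, so E reduces `Pr` of φ to `Pr` of 0 = 1, which `con`
  -- refutes.
  refutation : T ⊢ ¬̇ φ → T ⊢ ¬̇ Pr [ ⌜ φ ⌝ ]
  refutation d = ⇒-trans (∧E₁ (S⊑T _ (extensional _ (𝟘 ≐ 𝗌 𝟘) (∧I
    (⇒I (⊥E (⇒E (closed d) hyp₀)))
    (⇒I (⊥E (⇒E (closed (extendsPA _ (⇒I (𝗌≢𝟘 (≐sym hyp₀))))) hyp₀))))))) con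

  refutation* : ∀ i → T ⊢ ¬̇ φ → T ⊢ ¬̇ iterate Pr i φ
  refutation* zero    d = d
  refutation* (suc i) d = refutation (refutation* i d)

  -- C merges the conjuncts under one `Pr`, to which `refutation` applies.
  incompatible* : ∀ i → T ⊢ ¬̇ (φ ∧̇ ψ) → T ⊢ ¬̇ (iterate Pr i φ ∧̇ iterate Pr i ψ)
  incompatible*         zero    d = d
  incompatible* {φ} {ψ} (suc i) d =
    ⇒-trans (S⊑T _ (conjunctive (iterate Pr i φ) (iterate Pr i ψ))) (refutation (incompatible* i d))

  -- E passes the equivalence through the innermost `Pr`. The formulas vary in the recursion since
  -- both iterates are rebuilt from the inside.
  wrapped-⇔ : ∀ j → T ⊢ φ ⇔̇ ψ → T ⊢ wrapped Pr j φ ⇔̇ iterate Pr j ψ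
  wrapped-⇔         zero    d = d
  wrapped-⇔ {φ} {ψ} (suc j) d =
    wrapped-⇔ j (⇔-trans (wrap-⇔ (gödel φ) Pr) (S⊑T _ (extensional φ ψ d)))
    ∼ cong (wrapped Pr (suc j) φ ⇔̇_) (iterate-suc Pr j ψ)

  -- n * k = suc K
  K : ℕ
  K = k-1 + n-1 * k

  G : Formula
  G = proj₁ (diagonal Pr K)

  G-fixed : T ⊢ G ⇔̇ ¬̇ iterate Pr (n * k) G
  -- `diagonal` puts one `Pr` outside `wrapped`, so K inner ones make n * k in all.
  G-fixed = ⇔-trans (extendsPA _ (proj₂ (diagonal Pr K)))
    (¬-cong (S⊑T _ (extensional _ _ (wrapped-⇔ K (∧I (⇒I hyp₀) (⇒I hyp₀))))))

  ¬PrⁿG : T ⊢ ¬̇ iterate Pr n G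
  ¬PrⁿG = ⇒I (⇒E (closed (incompatible* n (⇒I (⇒E (⇒E (closed (∧E₁ G-fixed)) (∧E₁ hyp₀)) (∧E₂ hyp₀)))))
    (∧I hyp₀ (⇒E (closed (S⊑T _ (D3-multiple Pr {n = n} {k} d3 n G
      ∼ cong (iterate Pr n G ⇒_) (sym (iterate-+ Pr n (n * k) G))))) hyp₀)))

  ¬PrᴷG : T ⊢ ¬̇ iterate Pr (n * k) G
  -- As k is positive, n ≤ n * k; `refutation*` adds the o missing occurrences of `Pr`.
  ¬PrᴷG with m≤n⇒∃[o]m+o≡n (m≤m*n n k)
  ... | o , n+o≡n*k = refutation* o ¬PrⁿG
    ∼ cong ¬̇_ (trans (iterate-+ Pr o n G) (cong (λ i → iterate Pr i G) (trans (+-comm o n) n+o≡n*k)))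

  G-provable : T ⊢ G
  G-provable = ⇒E (∧E₂ G-fixed) ¬PrᴷG
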